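{- In general, the problem of computing an optimal robust temporally repeated flow is at least as hard as the static robust maximum flow problem: the static robust maximum flow problem is polynomial-time reducible to the problem of computing a feasible temporally repeated flow of maximum robust value.
   Context: $\mathbb N$ contains $0$. Optimal robust temporally repeated flow. An instance of the robust maximum flow over time problem consists of a finite directed graph $G=(V,E)$ (parallel edges allowed), a source $s\in V$ and a destination $d\in V$, where $d$ has no outgoing edges, capacities $u:E\to\mathbb N$, travel times $\tau:E\to\mathbb N$, delays $\Delta:E\to\mathbb N$, a time horizon $T\in\mathbb N$, $T\ge 1$, and an integer $\Gamma\in\mathbb N$. Let $\mathcal P$ be the set of simple $s$-$d$-paths and $\mathcal S=\{z\in\{0,1\}^{E}:\sum_{e\in E}z_e\le\Gamma\}$ the set of scenarios. For $P\in\mathcal P$ put $\tau(P)=\sum_{e\in P}\tau_e$ and $\Delta_z(P)=\sum_{e\in P}\Delta_e z_e$. A feasible temporally repeated flow is given by $x_P\ge0$ $(P\in\mathcal P)$ with $\sum_{P\ni e}x_P\le u_e$ for all $e\in E$; it sends flow into $P$ at rate $x_P$ during the dispatch interval $[0,T-\tau(P))$ (nothing if $\tau(P)\ge T$). Its robust value, the amount of flow guaranteed to reach $d$ by time $T$, is $\min_{z\in\mathcal S}\sum_{P\in\mathcal P}x_P\max\{0,T-\tau(P)-\Delta_z(P)\}$. The task is to find a feasible temporally repeated flow of maximum robust value. Static robust maximum flow problem. An instance consists of a directed graph $G=(V,E)$, vertices $s,d$, where $d$ has no outgoing edges, capacities $u:E\to\mathbb N$ and $\Gamma\in\mathbb N$.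 The task is to find $x_P\ge0$ for the simple $s$-$d$-paths $P$ with $\sum_{P\ni e}x_P\le u_e$ for all $e\in E$, maximizing $\min_{F\subseteq E,\ |F|\le\Gamma}\ \sum_{P:\,P\cap F=\emptyset}x_P$ (the flow surviving the failure of at most $\Gamma$ edges, without rerouting).
   Formalization: The flow rates x_P are rational rather than real in both problems, and maximality of the robust value is required only among feasible flows with rational rates; all other data are natural numbers as stated. -}

module Defs where

open import Data.Bool.Base using (if_then_else_)
open import Data.Digit using (Bit; 0b; 1b; toDigits)
open import Data.Fin.Base using (Fin; toℕ)
open import Data.Fin.Properties using (_≟_)
open import Data.Fin.Subset using (Subset; inside; outside; ∣_∣; ⊥)
open import Data.Fin.Subset.Properties using () renaming (_∈?_ to _∈ˢ?_)
open import Data.Integer.Base as ℤ using (ℤ; +_)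
open import Data.List.Base as List
  using (List; []; _∷_; _++_; map; filter; foldr; concatMap; allFin; catMaybes; length; replicate)
import Data.List.Extrema as Extrema
import Data.List.Membership.DecPropositional as DecMembership
open import Data.List.Relation.Unary.All using (All; all?)
open import Data.List.Relation.Unary.Unique.Propositional using (Unique)
open import Data.Maybe.Base as Maybe using (Maybe; just; nothing)
open import Data.Nat.Base using (ℕ; zero; suc; _+_; _*_; _∸_; _^_; _≤_)
open import Data.Nat.ListAction using (sum)
import Data.Nat.Properties as ℕₚ
open import Data.Product.Base using (_×_; _,_; ∃; ∃-syntax; proj₁; proj₂)
open import Data.Rational.Base as ℚ using (ℚ; 0ℚ; ↥_; ↧ₙ_)
open import Data.Rational.Properties using (≤-decTotalOrder)
open import Data.Sign.Base using (Sign)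
open import Data.Vec.Base as Vec using (Vec; []; _∷_; lookup)
open import Relation.Binary.Bundles using (module DecTotalOrder)
open import Relation.Binary.PropositionalEquality using (_≡_; _≢_)
open import Relation.Nullary.Decidable using (¬?)

------------------------------------------------------------------------
-- Polynomial-time computability by multi-tape Turing machines

data Symbol : Set where
  bit       : Bit → Symbol
  comma end : Symbol

Word : Set
Word = List Symbol

-- `nothing` is the blank.
Cell : Set
Cell = Maybe Symbol

-- Two-way infinite tape: cells outside both lists are blank, and `before`
-- lists the cells left of the head, nearest first.
record Tape : Set where
  constructor tape
  field
    before : List Cell
    head   : Cell
    after  : List Cell

data Move : Set where
  left stay right : Move

move : Move → Tape → Tape
move stay  t                     = t
move left  (tape []       c rs)  = tape [] nothing (c ∷ rs)
move left  (tape (l ∷ ls) c rs)  = tape ls l (c ∷ rs)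
move right (tape ls c [])        = tape (c ∷ ls) nothing []
move right (tape ls c (r ∷ rs))  = tape (c ∷ ls) r rs

writeMove : Cell × Move → Tape → Tape
writeMove (c , μ) (tape ls _ rs) = move μ (tape ls c rs)

blankTape : Tape
blankTape = tape [] nothing []

load : Word → Tape
load []      = blankTape
load (a ∷ w) = tape [] (just a) (map just w)

contents : Tape → Word
contents (tape ls c rs) = catMaybes (List.reverse ls ++ c ∷ rs)

-- A deterministic machine with one output tape, k input tapes and a finite
-- number of work tapes (in this order); it halts when δ is `nothing`.
record Machine (k : ℕ) : Set where
  field
    states work : ℕ

  tapes : ℕ
  tapes = suc (k + work)

  field
    start : Fin states
    δ     : Fin states → Vec Cell tapes → Maybe (Fin states × Vec (Cell × Move) tapes)

  Config : Set
  Config = Fin states × Vec Tape tapes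

  initial : Vec Word k → Config
  initial ws = start , blankTape ∷ (Vec.map load ws Vec.++ Vec.replicate work blankTape)

  step : Config → Maybe Config
  step (q , ts) =
    Maybe.map (λ (q′ , as) → q′ , Vec.zipWith writeMove as ts) (δ q (Vec.map Tape.head ts))

  output : Config → Word
  output (_ , ts) = contents (Vec.head ts)

  data _⇓[_]_ : Config → ℕ → Config → Set where
    halt : ∀ {c} → step c ≡ nothing → c ⇓[ 0 ] c
    next : ∀ {c c′ c″ t} → step c ≡ just c′ → c′ ⇓[ t ] c″ → c ⇓[ suc t ] c″

totalLength : ∀ {k} → Vec Word k → ℕ
totalLength ws = Vec.sum (Vec.map length ws)

PolyTime : ∀ {k} → (Vec Word k → Word) → Set
PolyTime {k} f =
  ∃[ M ] ∃[ a ] ∃[ b ] ∀ (ws : Vec Word k) → let open Machine M in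
    ∃[ t ] ∃[ c ] (initial ws ⇓[ t ] c) × (output c ≡ f ws) × (t ≤ a * totalLength ws ^ b + a)

------------------------------------------------------------------------
-- Optimization problems and reductions between them

record MaximizationProblem : Set₁ where
  field
    Instance  : Set
    Candidate : Instance → Set
    Feasible  : ∀ I → Candidate I → Set
    value     : ∀ I → Candidate I → ℚ
    encodeInstance  : Instance → Word
    encodeCandidate : ∀ I → Candidate I → Word

  Optimal : ∀ I → Candidate I → Set
  Optimal I x = Feasible I x × (∀ y → Feasible I y → value I y ℚ.≤ value I x)

  Solvable : Instance → Set
  Solvable I = ∃[ x ] Optimal I x

-- A reduction between the problems of computing an optimal solution:
-- instances of A are translated to instances of B, and an optimal solution
-- of the translated instance is translated back to one of the original.
-- Solvability must be preserved because an instance may have no optimal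
-- solution (e.g. unbounded flow if the source equals the destination).
record _≤ₚ_ (A B : MaximizationProblem) : Set where
  private
    module A = MaximizationProblem A
    module B = MaximizationProblem B
  field
    mapInstance : Vec Word 1 → Word
    mapSolution : Vec Word 2 → Word
    mapInstance-polyTime : PolyTime mapInstance
    mapSolution-polyTime : PolyTime mapSolution
    correct : ∀ (I : A.Instance) → ∃[ J ]
      (mapInstance (A.encodeInstance I ∷ []) ≡ B.encodeInstance J)
      × (A.Solvable I → B.Solvable J)
      × (∀ y → B.Optimal J y → ∃[ x ] A.Optimal I x ×
           mapSolution (A.encodeInstance I ∷ B.encodeCandidate J y ∷ []) ≡ A.encodeCandidate I x)

------------------------------------------------------------------------
-- Networks and path flows

ℕ→ℚ : ℕ → ℚ
ℕ→ℚ n = + n ℚ./ 1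

sumℚ : List ℚ → ℚ
sumℚ = foldr ℚ._+_ 0ℚ

record Network : Set where
  field
    ∣V∣ ∣E∣   : ℕ
    tail head : Fin ∣E∣ → Fin ∣V∣
    s d       : Fin ∣V∣
    u         : Fin ∣E∣ → ℕ
    d-noOut   : ∀ e → tail e ≢ d

  V E : Set
  V = Fin ∣V∣
  E = Fin ∣E∣

  open DecMembership (_≟_ {∣E∣}) using (_∈?_)

  data Walk : V → List E → V → Set where
    nil  : ∀ {v} → Walk v [] v
    cons : ∀ {P w} e → Walk (head e) P w → Walk (tail e) (e ∷ P) w

  SimplePath : List E → Set
  SimplePath P = Walk s P d × Unique (s ∷ map head P)

  -- A flow (x_P) lists pairs (P , x_P); paths not listed carry 0.
  PathFlow : Set
  PathFlow = List (List E × ℚ)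

  load-on : E → PathFlow → ℚ
  load-on e x = sumℚ (map proj₂ (filter (λ (P , _) → e ∈? P) x))

  record IsFeasible (x : PathFlow) : Set where
    field
      paths    : All (λ (P , _) → SimplePath P) x
      distinct : Unique (map proj₁ x)
      nonneg   : All (λ (_ , r) → 0ℚ ℚ.≤ r) x
      capacity : ∀ e → load-on e x ℚ.≤ ℕ→ℚ (u e)

-- A subset of E is also its characteristic vector z ∈ {0,1}^E.
subsets : ∀ m → List (Subset m)
subsets zero    = [] ∷ []
subsets (suc m) = map (outside ∷_) (subsets m) ++ map (inside ∷_) (subsets m)

subsetsUpTo : ∀ m → ℕ → List (Subset m)
subsetsUpTo m Γ = filter (λ z → ∣ z ∣ ℕₚ.≤? Γ) (subsets m)

-- ⊥ is itself in subsetsUpTo m Γ; it only serves as the start of the fold.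
minUpTo : ∀ {m} → ℕ → (Subset m → ℚ) → ℚ
minUpTo {m} Γ f = min (f ⊥) (map f (subsetsUpTo m Γ))
  where open Extrema (DecTotalOrder.totalOrder ≤-decTotalOrder) using (min)

------------------------------------------------------------------------
-- Encodings

-- Binary, least significant bit first.
encodeℕ : ℕ → Word
encodeℕ n = map bit (proj₁ (toDigits 2 n)) ++ comma ∷ []

encodeℕs : List ℕ → Word
encodeℕs ns = concatMap encodeℕ ns ++ end ∷ []

-- Unary: the size of an instance is to be at least its number of vertices.
encodeUnary : ℕ → Word
encodeUnary n = replicate n (bit 1b) ++ comma ∷ []

encodeSign : Sign → Word
encodeSign Sign.+ = bit 0b ∷ []
encodeSign Sign.- = bit 1b ∷ []

encodeℚ : ℚ → Word
encodeℚ r = encodeSign (ℤ.sign (↥ r)) ++ encodeℕs (ℤ.∣ ↥ r ∣ ∷ ↧ₙ r ∷ [])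

encodePathFlow : ∀ N → Network.PathFlow N → Word
encodePathFlow N = concatMap (λ (P , r) → encodeℕs (map toℕ P) ++ encodeℚ r)

-- The word lists the vertex count, then s, d and the global parameters of an
-- instance, then for each edge its ends, its capacity and its further
-- attributes.
encodeNetwork : (N : Network) → List ℕ → (Network.E N → List ℕ) → Word
encodeNetwork N params attributes =
  encodeUnary ∣V∣ ++ encodeℕs (toℕ s ∷ toℕ d ∷ params) ++
  concatMap (λ e → encodeℕs (toℕ (tail e) ∷ toℕ (head e) ∷ u e ∷ attributes e)) (allFin ∣E∣)
  where open Network N

------------------------------------------------------------------------
-- The static robust maximum flow problem

record StaticInstance : Set where
  field
    network : Network
    Γ       : ℕ
  open Network network public

  surviving : PathFlow → Subset ∣E∣ → ℚ
  surviving x F = sumℚ (map proj₂ (filter (λ (P , _) → all? (λ e → ¬? (e ∈ˢ? F)) P) x))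

  robustValue : PathFlow → ℚ
  robustValue x = minUpTo Γ (surviving x)

StaticRobustMaxFlow : MaximizationProblem
StaticRobustMaxFlow = record
  { Instance        = StaticInstance
  ; Candidate       = StaticInstance.PathFlow
  ; Feasible        = StaticInstance.IsFeasible
  ; value           = StaticInstance.robustValue
  ; encodeInstance  = λ I → let open StaticInstance I in
                      encodeNetwork network (Γ ∷ []) (λ _ → [])
  ; encodeCandidate = λ I → encodePathFlow (StaticInstance.network I)
  }

------------------------------------------------------------------------
-- The robust maximum flow over time problem

record OverTimeInstance : Set where
  field
    network : Network
    Γ T     : ℕ
    T≥1     : 1 ≤ T
  open Network network public
  field
    τ Δ     : E → ℕ

  Scenario : Set
  Scenario = Subset ∣E∣

  travelTime : List E → ℕ
  travelTime P = sum (map τ P)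

  delay : Scenario → List E → ℕ
  delay z P = sum (map (λ e → Δ e * (if lookup z e then 1 else 0)) P)

  -- Truncated subtraction is max{0 , T − τ(P) − Δ_z(P)}.
  arriving : PathFlow → Scenario → ℚ
  arriving x z = sumℚ (map (λ (P , r) → r ℚ.* ℕ→ℚ (T ∸ travelTime P ∸ delay z P)) x)

  robustValue : PathFlow → ℚ
  robustValue x = minUpTo Γ (arriving x)

RobustTemporallyRepeatedFlow : MaximizationProblem
RobustTemporallyRepeatedFlow = record
  { Instance        = OverTimeInstance
  ; Candidate       = OverTimeInstance.PathFlow
  ; Feasible        = OverTimeInstance.IsFeasible
  ; value           = OverTimeInstance.robustValue
  ; encodeInstance  = λ I → let open OverTimeInstance I in
                      encodeNetwork network (Γ ∷ T ∷ []) (λ e → τ e ∷ Δ e ∷ [])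
  ; encodeCandidate = λ I → encodePathFlow (OverTimeInstance.network I)
  }

{-# OPTIONS --safe #-}

-- Keep the network and put T = 1, τ = 0, Δ = 1: a path then delivers
-- max{0 , 1 − |P ∩ F|} times its flow, i.e. all of it if it avoids the failing
-- edges F and nothing otherwise. So every path flow has the same robust value
-- in both instances, and solutions are translated back by copying them.
-- On encodings the instance is translated by a finite-state transducer, which
-- inserts the number 1 (for T) before the first `end` and the numbers 0 , 1
-- (for τ and Δ of an edge) before every later one.
module Submission where

open import Data.Bool.Base using (if_then_else_)
open import Data.Digit using (0b; 1b; toDigits)
open import Data.Fin.Base using (Fin; zero; suc; toℕ)
open import Data.Fin.Subset using (Subset; inside; outside)
open import Data.Fin.Subset.Properties using () renaming (_∈?_ to _∈ˢ?_)
open import Data.List.Base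
  using (List; []; _∷_; _++_; _ʳ++_; map; concatMap; catMaybes; length; reverse; allFin)
open import Data.List.Properties
  using (++-assoc; map-cong; reverse-map; ʳ++-defn; catMaybes-++)
open import Data.List.Relation.Unary.All using (all?)
open import Data.Maybe.Base using (Maybe; just; nothing)
open import Data.Nat.Base using (ℕ; zero; suc; _+_; _*_; _∸_; _^_; _≤_; z≤n; s≤s)
import Data.Nat.Properties as ℕₚ
open import Data.Product.Base using (_×_; _,_; ∃-syntax; proj₁)
open import Data.Rational.Base as ℚ using (ℚ)
import Data.Rational.Properties as ℚₚ
open import Data.Vec.Base as Vec using (Vec; []; _∷_; lookup)
open import Data.Vec.Properties using (lookup⇒[]=; []=⇒lookup)
open import Function.Base using (_∘_)
open import Relation.Binary.PropositionalEquality
  using (_≡_; _≗_; refl; sym; trans; cong; subst; subst₂; module ≡-Reasoning)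
open import Relation.Nullary using (yes; no; does)
open import Relation.Nullary.Decidable using (¬?)

open import Defs

-- Tapes in a left-to-right pass, and running times

inputTape : List Cell → Word → Tape
inputTape ls []      = tape ls nothing []
inputTape ls (a ∷ w) = tape ls (just a) (map just w)

-- The output written so far is kept latest symbol first, matching the order of `before`; hence the
-- results below have the form `v ʳ++ w`.
outputTape : Word → Tape
outputTape v = tape (map just v) nothing []

load≡inputTape : ∀ w → load w ≡ inputTape [] w
load≡inputTape []      = refl
load≡inputTape (_ ∷ _) = refl

move-right-inputTape : ∀ ls c w → move right (tape ls c (map just w)) ≡ inputTape (c ∷ ls) w
move-right-inputTape ls c []      = refl
move-right-inputTape ls c (_ ∷ _) = refl

catMaybes-map-just : ∀ (w : Word) → catMaybes (map just w) ≡ w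
catMaybes-map-just []      = refl
catMaybes-map-just (a ∷ w) = cong (a ∷_) (catMaybes-map-just w)

contents-outputTape : ∀ v → contents (outputTape v) ≡ v ʳ++ []
contents-outputTape v = begin
  catMaybes (reverse (map just v) ++ nothing ∷ [])  ≡⟨ catMaybes-++ (reverse (map just v)) _ ⟩
  catMaybes (reverse (map just v)) ++ []            ≡⟨ cong (λ w → catMaybes w ++ []) (reverse-map just v) ⟨
  catMaybes (map just (reverse v)) ++ []            ≡⟨ cong (_++ []) (catMaybes-map-just (reverse v)) ⟩
  reverse v ++ []                                   ≡⟨ ʳ++-defn v ⟨
  v ʳ++ []                                          ∎
  where open ≡-Reasoning

module _ {k} (M : Machine k) where
  open Machine M

  Computes : Config → Word → ℕ → Set
  Computes c v n = ∃[ t ] ∃[ c′ ] (c ⇓[ t ] c′) × (output c′ ≡ v) × (t ≤ n)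

module _ {k} {M : Machine k} where
  open Machine M

  computes-step : ∀ {c c′ v n} → step c ≡ just c′ → Computes M c′ v n → Computes M c v (suc n)
  computes-step eq (_ , _ , run , out , t≤n) = _ , _ , next eq run , out , s≤s t≤n

  computes-mono : ∀ {c v m n} → m ≤ n → Computes M c v m → Computes M c v n
  computes-mono m≤n (_ , _ , run , out , t≤m) = _ , _ , run , out , ℕₚ.≤-trans t≤m m≤n

linearTime⇒polyTime : ∀ {k} {f : Vec Word k → Word} (M : Machine k) a →
  (∀ ws → Computes M (Machine.initial M ws) (f ws) (totalLength ws * a)) → PolyTime f
linearTime⇒polyTime M a run = M , a , 1 , λ ws → computes-mono (bound (totalLength ws)) (run ws)
  where
  bound : ∀ n → n * a ≤ a * n ^ 1 + a
  bound n = begin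
    n * a          ≡⟨ ℕₚ.*-comm n a ⟩
    a * n          ≡⟨ cong (a *_) (ℕₚ.^-identityʳ n) ⟨
    a * n ^ 1      ≤⟨ ℕₚ.m≤m+n _ a ⟩
    a * n ^ 1 + a  ∎
    where open ℕₚ.≤-Reasoning

-- The transducer on instance words

extend : Word → Word → Word → Word
extend x y []            = []
-- In an encoded instance the first `end` closes the parameters and every later one an edge record;
-- hence the switch from `x` to `y`.
extend x y (end ∷ w)     = x ++ end ∷ extend y y w
extend x y (comma ∷ w)   = comma ∷ extend x y w
extend x y (bit b ∷ w)   = bit b ∷ extend x y w

paramExtension edgeExtension : Word
paramExtension = encodeℕ 1
edgeExtension  = encodeℕ 0 ++ encodeℕ 1

-- `paramᵢ` and `edgeᵢ` have already inserted i symbols before the current `end`.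
pattern param₀ = zero
pattern param₁ = suc zero
pattern param₂ = suc (suc zero)
pattern edge₀  = suc (suc (suc zero))
pattern edge₁  = suc (suc (suc (suc zero)))
pattern edge₂  = suc (suc (suc (suc (suc zero))))
pattern edge₃  = suc (suc (suc (suc (suc (suc zero)))))
pattern edge₄  = suc (suc (suc (suc (suc (suc (suc zero))))))

extendMachine : Machine 1
extendMachine = record { states = 8 ; work = 0 ; start = param₀ ; δ = δ }
  where
  -- A step writes one symbol, so an insertion takes several steps: with `stay` the input head waits
  -- on the `end`, with `right` it passes it.
  emit : Symbol → Move → Fin 8 → Maybe (Fin 8 × Vec (Cell × Move) 2)
  emit a μ q = just (q , (just a , right) ∷ (just end , μ) ∷ [])

  copy : Symbol → Fin 8 → Maybe (Fin 8 × Vec (Cell × Move) 2)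
  copy a q = just (q , (just a , right) ∷ (just a , right) ∷ [])

  δ : Fin 8 → Vec Cell 2 → Maybe (Fin 8 × Vec (Cell × Move) 2)
  δ q      (_ ∷ nothing      ∷ []) = nothing
  δ q      (_ ∷ just (bit b) ∷ []) = copy (bit b) q
  δ q      (_ ∷ just comma   ∷ []) = copy comma q
  δ param₀ (_ ∷ just end     ∷ []) = emit (bit 1b) stay  param₁
  δ param₁ (_ ∷ just end     ∷ []) = emit comma    stay  param₂
  δ param₂ (_ ∷ just end     ∷ []) = emit end      right edge₀
  δ edge₀  (_ ∷ just end     ∷ []) = emit (bit 0b) stay  edge₁
  δ edge₁  (_ ∷ just end     ∷ []) = emit comma    stay  edge₂
  δ edge₂  (_ ∷ just end     ∷ []) = emit (bit 1b) stay  edge₃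
  δ edge₃  (_ ∷ just end     ∷ []) = emit comma    stay  edge₄
  δ edge₄  (_ ∷ just end     ∷ []) = emit end      right edge₀

module _ where
  private
    config : Fin 8 → Word → Tape → Machine.Config extendMachine
    config q v t = q , outputTape v ∷ t ∷ []

    -- `move right` is stuck on `map just w` until `w` is split, so the transitions that consume a
    -- symbol need this equation in place of `refl`.
    advance : ∀ q v ls c w →
      just (config q v (move right (tape ls c (map just w)))) ≡ just (config q v (inputTape (c ∷ ls) w))
    advance q v ls c w = cong (just ∘ config q v) (move-right-inputTape ls c w)

    copied : ∀ n → suc (n * 5) ≤ suc n * 5
    copied n = ℕₚ.+-monoˡ-≤ (n * 5) (s≤s z≤n)

  -- Five steps per input symbol suffice: the costliest symbol is an `end`, where four symbols are
  -- inserted before it is copied.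
  computes-edges : ∀ v ls w →
    Computes extendMachine (config edge₀ v (inputTape ls w))
      (v ʳ++ extend edgeExtension edgeExtension w) (length w * 5)
  computes-edges v ls []          = 0 , _ , Machine.halt refl , contents-outputTape v , z≤n
  computes-edges v ls (bit b ∷ w) = computes-mono (copied (length w))
    (computes-step (advance edge₀ _ ls _ w) (computes-edges (bit b ∷ v) _ w))
  computes-edges v ls (comma ∷ w) = computes-mono (copied (length w))
    (computes-step (advance edge₀ _ ls _ w) (computes-edges (comma ∷ v) _ w))
  computes-edges v ls (end ∷ w)   =
    computes-step refl (computes-step refl (computes-step refl (computes-step refl
      (computes-step (advance edge₀ _ ls _ w) (computes-edges _ _ w)))))

  computes-params : ∀ v ls w →
    Computes extendMachine (config param₀ v (inputTape ls w))
      (v ʳ++ extend paramExtension edgeExtension w) (length w * 5)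
  computes-params v ls []          = 0 , _ , Machine.halt refl , contents-outputTape v , z≤n
  computes-params v ls (bit b ∷ w) = computes-mono (copied (length w))
    (computes-step (advance param₀ _ ls _ w) (computes-params (bit b ∷ v) _ w))
  computes-params v ls (comma ∷ w) = computes-mono (copied (length w))
    (computes-step (advance param₀ _ ls _ w) (computes-params (comma ∷ v) _ w))
  -- Only two symbols are inserted here, so three of the five steps are spent.
  computes-params v ls (end ∷ w)   = computes-mono (ℕₚ.+-monoˡ-≤ (length w * 5) (s≤s (s≤s (s≤s z≤n))))
    (computes-step refl (computes-step refl
      (computes-step (advance edge₀ _ ls _ w) (computes-edges _ _ w))))

extendInstance : Vec Word 1 → Word
extendInstance (w ∷ []) = extend paramExtension edgeExtension w

extendInstance-polyTime : PolyTime extendInstance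
extendInstance-polyTime = linearTime⇒polyTime extendMachine 5 λ where
  (w ∷ []) → subst₂
    (λ t n → Computes extendMachine (param₀ , blankTape ∷ t ∷ []) (extendInstance (w ∷ [])) (n * 5))
    (sym (load≡inputTape w)) (sym (ℕₚ.+-identityʳ (length w))) (computes-params [] [] w)

-- Copying the encoded solution

copyMachine : Machine 2
copyMachine = record { states = 1 ; work = 0 ; start = zero ; δ = δ }
  where
  δ : Fin 1 → Vec Cell 3 → Maybe (Fin 1 × Vec (Cell × Move) 3)
  δ q (_ ∷ _ ∷ nothing ∷ []) = nothing
  δ q (_ ∷ c ∷ just a  ∷ []) =
    -- Writing `c` back without moving preserves the first input tape, which is therefore a fixed
    -- `t` in the induction.
    just (q , (just a , right) ∷ (c , stay) ∷ (just a , right) ∷ [])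

computes-copy : ∀ v t ls w →
  Computes copyMachine (zero , outputTape v ∷ t ∷ inputTape ls w ∷ []) (v ʳ++ w) (length w)
computes-copy v t ls []      = 0 , _ , Machine.halt refl , contents-outputTape v , z≤n
computes-copy v t ls (a ∷ w) = computes-step
  (cong (λ t′ → just (zero , outputTape (a ∷ v) ∷ t ∷ t′ ∷ [])) (move-right-inputTape ls (just a) w))
  (computes-copy (a ∷ v) t _ w)

copySecond : Vec Word 2 → Word
copySecond (_ ∷ w ∷ []) = w

copySecond-polyTime : PolyTime copySecond
copySecond-polyTime = linearTime⇒polyTime copyMachine 1 λ where
    (v ∷ w ∷ []) → computes-mono (bound (length v) (length w))
      (subst (λ t → Computes copyMachine (zero , blankTape ∷ load v ∷ t ∷ []) w (length w))
        (sym (load≡inputTape w)) (computes-copy [] (load v) [] w))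
  where
  bound : ∀ m n → n ≤ (m + (n + 0)) * 1
  bound m n = begin
    n                  ≡⟨ ℕₚ.+-identityʳ n ⟨
    n + 0              ≤⟨ ℕₚ.m≤n+m (n + 0) m ⟩
    m + (n + 0)        ≡⟨ ℕₚ.*-identityʳ _ ⟨
    (m + (n + 0)) * 1  ∎
    where open ℕₚ.≤-Reasoning

-- The transducer on encoded networks

module _ (x y : Word) where

  extend-bits : ∀ bs v → extend x y (map bit bs ++ v) ≡ map bit bs ++ extend x y v
  extend-bits []       v = refl
  extend-bits (b ∷ bs) v = cong (bit b ∷_) (extend-bits bs v)

  extend-bits,comma : ∀ bs v →
    extend x y ((map bit bs ++ comma ∷ []) ++ v) ≡ (map bit bs ++ comma ∷ []) ++ extend x y v
  extend-bits,comma bs v = begin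
    extend x y ((map bit bs ++ comma ∷ []) ++ v)  ≡⟨ cong (extend x y) (++-assoc (map bit bs) _ v) ⟩
    extend x y (map bit bs ++ comma ∷ v)          ≡⟨ extend-bits bs (comma ∷ v) ⟩
    map bit bs ++ comma ∷ extend x y v            ≡⟨ ++-assoc (map bit bs) _ _ ⟨
    (map bit bs ++ comma ∷ []) ++ extend x y v    ∎
    where open ≡-Reasoning

  extend-encodeUnary : ∀ n v → extend x y (encodeUnary n ++ v) ≡ encodeUnary n ++ extend x y v
  extend-encodeUnary zero    v = refl
  extend-encodeUnary (suc n) v = cong (bit 1b ∷_) (extend-encodeUnary n v)

  -- Digits and commas pass through unchanged, and the only `end` in `encodeℕs ns` is its
  -- terminator; inserting `x` there appends `ms` to the list.
  extend-encodeℕs : ∀ ns ms v → x ≡ concatMap encodeℕ ms →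
    extend x y (encodeℕs ns ++ v) ≡ encodeℕs (ns ++ ms) ++ extend y y v
  extend-encodeℕs []       ms v refl = sym (++-assoc (concatMap encodeℕ ms) _ _)
  extend-encodeℕs (n ∷ ns) ms v eq   = begin
    extend x y (((encodeℕ n ++ concatMap encodeℕ ns) ++ end ∷ []) ++ v)
      ≡⟨ cong (extend x y) (reassoc (concatMap encodeℕ ns) v) ⟩
    extend x y (encodeℕ n ++ (encodeℕs ns ++ v))
      ≡⟨ extend-bits,comma (proj₁ (toDigits 2 n)) _ ⟩
    encodeℕ n ++ extend x y (encodeℕs ns ++ v)
      ≡⟨ cong (encodeℕ n ++_) (extend-encodeℕs ns ms v eq) ⟩
    encodeℕ n ++ (encodeℕs (ns ++ ms) ++ extend y y v)
      ≡⟨ reassoc (concatMap encodeℕ (ns ++ ms)) (extend y y v) ⟨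
    ((encodeℕ n ++ concatMap encodeℕ (ns ++ ms)) ++ end ∷ []) ++ extend y y v
      ∎
    where
    open ≡-Reasoning
    reassoc : ∀ p q → ((encodeℕ n ++ p) ++ end ∷ []) ++ q ≡ encodeℕ n ++ ((p ++ end ∷ []) ++ q)
    reassoc p q = trans (cong (_++ q) (++-assoc (encodeℕ n) p _)) (++-assoc (encodeℕ n) _ q)

extend-records : ∀ {A : Set} y ms (f : A → List ℕ) → y ≡ concatMap encodeℕ ms → ∀ es →
  extend y y (concatMap (encodeℕs ∘ f) es) ≡ concatMap (λ e → encodeℕs (f e ++ ms)) es
extend-records y ms f eq []       = refl
extend-records y ms f eq (e ∷ es) = trans
  (extend-encodeℕs y y (f e) ms _ eq)
  (cong (encodeℕs (f e ++ ms) ++_) (extend-records y ms f eq es))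

-- The unary vertex count contains no `end`, so the first insertion falls behind the parameters `ps`
-- and the others behind the edge records.
extend-encodeNetwork : ∀ N ps →
  extend paramExtension edgeExtension (encodeNetwork N ps (λ _ → []))
    ≡ encodeNetwork N (ps ++ 1 ∷ []) (λ _ → 0 ∷ 1 ∷ [])
extend-encodeNetwork N ps = begin
  extend p e (encodeUnary ∣V∣ ++ encodeℕs ns ++ concatMap (encodeℕs ∘ record₀) (allFin ∣E∣))
    ≡⟨ extend-encodeUnary p e ∣V∣ _ ⟩
  encodeUnary ∣V∣ ++ extend p e (encodeℕs ns ++ concatMap (encodeℕs ∘ record₀) (allFin ∣E∣))
    ≡⟨ cong (encodeUnary ∣V∣ ++_) (extend-encodeℕs p e ns (1 ∷ []) _ refl) ⟩
  encodeUnary ∣V∣ ++ encodeℕs (ns ++ 1 ∷ []) ++ extend e e (concatMap (encodeℕs ∘ record₀) (allFin ∣E∣))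
    ≡⟨ cong (λ w → encodeUnary ∣V∣ ++ encodeℕs (ns ++ 1 ∷ []) ++ w)
         (extend-records e (0 ∷ 1 ∷ []) record₀ refl (allFin ∣E∣)) ⟩
  encodeNetwork N (ps ++ 1 ∷ []) (λ _ → 0 ∷ 1 ∷ [])
    ∎
  where
  open ≡-Reasoning
  open Network N
  p = paramExtension
  e = edgeExtension
  ns = toℕ s ∷ toℕ d ∷ ps
  record₀ : E → List ℕ
  record₀ e = toℕ (tail e) ∷ toℕ (head e) ∷ u e ∷ []

-- Equality of the robust values

minUpTo-cong : ∀ {m} Γ {f g : Subset m → ℚ} → f ≗ g → minUpTo Γ f ≡ minUpTo Γ g
-- `Vec.replicate m outside` is `⊥`, whose value starts the fold.
minUpTo-cong {m} Γ {f} {g} f≗g rewrite f≗g (Vec.replicate m outside) | map-cong f≗g (subsetsUpTo m Γ) = refl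

module _ (I : StaticInstance) where
  private module S = StaticInstance I

  overTime : OverTimeInstance
  overTime = record
    { network = S.network ; Γ = S.Γ ; T = 1 ; T≥1 = s≤s z≤n ; τ = λ _ → 0 ; Δ = λ _ → 1 }

  private module O = OverTimeInstance overTime

  travelTime≡0 : ∀ P → O.travelTime P ≡ 0
  travelTime≡0 []      = refl
  travelTime≡0 (_ ∷ P) = travelTime≡0 P

  -- The first failing edge already uses up the horizon 1, and truncated subtraction absorbs the
  -- delays of any others.
  remainingTime : ∀ z P →
    1 ∸ O.delay z P ≡ (if does (all? (λ e → ¬? (e ∈ˢ? z)) P) then 1 else 0)
  remainingTime z []      = refl
  remainingTime z (e ∷ P) with e ∈ˢ? z
  ... | yes e∈z rewrite []=⇒lookup e∈z = ℕₚ.0∸n≡0 (O.delay z P)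
  -- `delay` evaluates `lookup z e` while survival is decided by membership; the case where they
  -- disagree is refuted.
  ... | no  e∉z with lookup z e in eq
  ...   | outside = remainingTime z P
  ...   | inside  with () ← e∉z (lookup⇒[]= e z eq)

  arriving≡surviving : ∀ x z → O.arriving x z ≡ S.surviving x z
  arriving≡surviving []            z = refl
  arriving≡surviving ((P , r) ∷ x) z
    rewrite travelTime≡0 P | remainingTime z P | arriving≡surviving x z
    with does (all? (λ e → ¬? (e ∈ˢ? z)) P)
  -- `inside` and `outside` are the booleans: the path survives with factor 1, or is filtered out
  -- and has factor 0.
  ... | inside  = cong (ℚ._+ S.surviving x z) (ℚₚ.*-identityʳ r)
  ... | outside = trans (cong (ℚ._+ S.surviving x z) (ℚₚ.*-zeroʳ r)) (ℚₚ.+-identityˡ _)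

  robustValue-overTime : ∀ x → O.robustValue x ≡ S.robustValue x
  robustValue-overTime x = minUpTo-cong S.Γ (arriving≡surviving x)

proposition4 : StaticRobustMaxFlow ≤ₚ RobustTemporallyRepeatedFlow
proposition4 = record
  { mapInstance          = extendInstance
  ; mapSolution          = copySecond
  ; mapInstance-polyTime = extendInstance-polyTime
  ; mapSolution-polyTime = copySecond-polyTime
  ; correct = λ I → let same = robustValue-overTime I; network = StaticInstance.network I in
      overTime I
    , extend-encodeNetwork network (StaticInstance.Γ I ∷ [])
    -- Feasibility depends only on the shared network, so only the inequalities between values are
    -- transported along `same`.
    , (λ (x , feasible , optimal) → x , feasible , λ y feasible′ →
         subst₂ ℚ._≤_ (sym (same y)) (sym (same x)) (optimal y feasible′))
    -- The same flow `y` is optimal for `I`, and both problems encode it by the same word.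
    , λ y (feasible , optimal) → y
      , (feasible , λ z feasible′ → subst₂ ℚ._≤_ (same z) (same y) (optimal z feasible′))
      , refl
  }
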